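{- Let $l\ge 2$ be an integer and let $w\geq 2$ be an odd integer. Then for every $1\le r\le l-1$ the column vector $b_r^{(1)}$ of numbers of brick-wall lattice paths of the first type ending in the column $x=r$ is given by $$b^{(1)}_r=\begin{cases}(M_LM_U)^{\rho}\,b_0, & r\text{ even},\\ M_U(M_LM_U)^{\rho}\,b_0, & r\text{ odd},\end{cases}\qquad \rho=\left\lfloor \frac r2\right\rfloor .$$ Hence the number of all brick-wall lattice paths of the first type connecting the left and right sides of the rectangle $\mathcal R$ with walks inside $\mathcal R$, which is the same as the number of such paths of the second type (so $\mathcal B^{(1)}_{l,w}=\mathcal B^{(2)}_{l,w}=:\mathcal B_{l,w}$), is $$\mathcal B_{l,w}=u\,b^{(1)}_{l-1},$$ where $u=(1,1,\dots,1)$ is the row matrix with $w$ components.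
   Context: A point $(a,b)\in\mathbf Z\times\mathbf Z$ is even (odd) if $|a|+|b|$ is even (odd). A brick-wall lattice path of the first type is a finite sequence of points of $\mathbf Z\times\mathbf Z$ in which each consecutive step is either the horizontal step $(1,0)$ (allowed from any point), or the step $(0,1)$ taken from an even point, or the step $(0,-1)$ taken from an odd point. A brick-wall lattice path of the second type is defined in the same way with the steps $(1,0)$ from any point, $(0,1)$ from an odd point, $(0,-1)$ from an even point. Paths visit no point more than once; the empty path (a single point) is allowed. Let $\mathcal R=[0,l-1]\times[0,w-1]$. For $t\in\{1,2\}$, $\mathcal B^{(t)}_{l,w}$ is the number of brick-wall lattice paths of type $t$ (type 1 = first, type 2 = second) starting at some point $(0,\alpha)$ and ending at some point $(l-1,\beta)$, with $\alpha,\beta\in\{0,\dots,w-1\}$, staying inside $\mathcal R$ and using no vertical step along the left side $x=0$ (vertical steps along the right side $x=l-1$ are allowed). For $0\le i\le l-1$, $0\le j\le w-1$, $b^{(t)}_{ij}$ is the number of such paths of type $t$ (inside $\mathcal R$, starting on the left side, no vertical step along $x=0$) ending at $(i,j)$, and $b^{(t)}_i$ is the column vector $(b^{(t)}_{i,w-1},b^{(t)}_{i,w-2},\dots,b^{(t)}_{i,1},b^{(t)}_{i,0})^T$. In particular $b^{(1)}_0=b^{(2)}_0=b_0$ is the all-ones column vector. Let $J=\begin{pmatrix}1&1\\1&1\end{pmatrix}$. For odd $w$, $M_U$ and $M_L$ are the $w\times w$ block-diagonal matrices $M_U=\mathrm{diag}(J,J,\dots,J,1)$ and $M_L=\mathrm{diag}(1,J,\dots,J,J)$,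 each with $(w-1)/2$ blocks $J$ and one $1\times1$ block $(1)$. -}

module Defs where

open import Data.Empty using (⊥-elim)
open import Data.Nat.Base as ℕ using (ℕ; zero; suc; _+_; _*_; s≤s; parity)
import Data.Nat.Properties as ℕₚ
open import Data.Integer.Base as ℤ using (ℤ; 0ℤ; 1ℤ; ∣_∣; +≤+) renaming (+_ to pos)
import Data.Integer.Properties as ℤₚ
open import Data.Parity.Base using (0ℙ; 1ℙ; _⁻¹)
import Data.Parity.Properties as ℙₚ
open import Data.Fin.Base as Fin using (Fin; toℕ; opposite; splitAt)
import Data.Fin.Properties as Finₚ
open import Data.Product using (_×_; _,_; proj₁; proj₂; ∃)
import Data.Product.Properties as Productₚ
open import Data.Sum.Base using (_⊎_; inj₁; inj₂)
open import Data.Maybe.Base using (just)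
import Data.Maybe.Properties as Maybeₚ
open import Data.List.Base
  using (List; []; _∷_; length; head; last; map; lookup; filter; upTo; deduplicate;
         cartesianProduct; cartesianProductWith)
import Data.List.Properties as Listₚ
open import Data.List.Membership.Propositional using (_∈_)
open import Data.List.Membership.Propositional.Properties
  using (∈-filter⁺; ∈-filter⁻; ∈-deduplicate⁺; ∈-deduplicate⁻; ∈-cartesianProduct⁺;
         ∈-cartesianProductWith⁺; ∈-map⁺; ∈-upTo⁺; ∈-lookup)
open import Data.List.Relation.Unary.All as All using (All; []; _∷_)
open import Data.List.Relation.Unary.Any as Any using (here; there)
open import Data.List.Relation.Unary.Any.Properties using (lookup-index)
open import Data.List.Relation.Unary.AllPairs using ([]; _∷_)
open import Data.List.Relation.Unary.Linked using (Linked; linked?)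
open import Data.List.Relation.Unary.Unique.Propositional using (Unique)
import Data.List.Relation.Unary.Unique.DecPropositional as DecUnique
import Data.List.Relation.Unary.Unique.DecPropositional.Properties as DecUniqueₚ
open import Data.Vec.Functional using (Vector)
open import Algebra.Properties.Semiring.Sum ℕₚ.+-*-semiring using (sum)
open import Function.Base using (_∘_)
open import Level using (0ℓ)
open import Relation.Binary.Core using (Rel)
open import Relation.Binary.Definitions using (DecidableEquality)
import Relation.Binary.Definitions as B
open import Relation.Binary.PropositionalEquality
  using (_≡_; refl; sym; trans; cong)
open import Relation.Nullary using (¬_; yes; no)
open import Relation.Nullary.Decidable using (_×-dec_; _⊎-dec_; ¬?)
open import Relation.Unary using (Pred; Decidable)

Point : Set
Point = ℤ × ℤ

EvenPoint OddPoint : Pred Point 0ℓ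
EvenPoint (a , b) = parity (∣ a ∣ + ∣ b ∣) ≡ 0ℙ
OddPoint  (a , b) = parity (∣ a ∣ + ∣ b ∣) ≡ 1ℙ

right up down : Point → Point
right (a , b) = a ℤ.+ 1ℤ , b
up    (a , b) = a , b ℤ.+ 1ℤ
down  (a , b) = a , b ℤ.- 1ℤ

data PathType : Set where
  first second : PathType

Step : PathType → Rel Point 0ℓ
Step first  p q = q ≡ right p ⊎ (EvenPoint p × q ≡ up p) ⊎ (OddPoint  p × q ≡ down p)
Step second p q = q ≡ right p ⊎ (OddPoint  p × q ≡ up p) ⊎ (EvenPoint p × q ≡ down p)

-- The rectangle [0,l-1]×[0,w-1].
InRectangle : ℕ → ℕ → Pred Point 0ℓ
InRectangle l w (a , b) =
  (0ℤ ℤ.≤ a × a ℤ.≤ pos l ℤ.- 1ℤ) × (0ℤ ℤ.≤ b × b ℤ.≤ pos w ℤ.- 1ℤ)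

-- For steps of a path, having both ends on x = 0 means being vertical there.
AlongLeft : Rel Point 0ℓ
AlongLeft (a , _) (a′ , _) = a ≡ 0ℤ × a′ ≡ 0ℤ

-- A path is the list of its points.  The condition on `head` makes the list
-- non-empty; a one-element list is an empty path.
record LeftPath (t : PathType) (l w : ℕ) (ps : List Point) : Set where
  constructor leftPath
  field
    steps         : Linked (Step t) ps
    simple        : Unique ps
    inside        : All (InRectangle l w) ps
    notAlongLeft  : Linked (λ p q → ¬ AlongLeft p q) ps
    startsOnLeft  : ∃ λ (α : Fin w) → head ps ≡ just (0ℤ , pos (toℕ α))

PathTo : PathType → (l w i j : ℕ) → Pred (List Point) 0ℓ
PathTo t l w i j ps = LeftPath t l w ps × last ps ≡ just (pos i , pos j)

CrossingPath : PathType → (l w : ℕ) → Pred (List Point) 0ℓ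
CrossingPath t l w ps =
  LeftPath t l w ps × ∃ λ (β : Fin w) → last ps ≡ just (pos l ℤ.- 1ℤ , pos (toℕ β))

-- Cardinality of a finite set {x ∣ P x}: the length of any list that contains
-- each x satisfying P exactly once and nothing else.

record Enumeration {A : Set} (P : Pred A 0ℓ) : Set where
  field
    elements : List A
    unique   : Unique elements
    sound    : ∀ {x} → x ∈ elements → P x
    complete : ∀ {x} → P x → x ∈ elements

#_ : {A : Set} {P : Pred A 0ℓ} → Enumeration P → ℕ
# E = length (Enumeration.elements E)

-- Simple lists over a finite set of points can be enumerated, because their
-- length is bounded by the number of points.

listsUpTo : {A : Set} → ℕ → List A → List (List A)
listsUpTo zero    ys = [] ∷ []
listsUpTo (suc n) ys = [] ∷ cartesianProductWith _∷_ ys (listsUpTo n ys)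

∈-listsUpTo : {A : Set} (n : ℕ) (ys : List A) {xs : List A} →
              length xs ℕ.≤ n → All (_∈ ys) xs → xs ∈ listsUpTo n ys
∈-listsUpTo zero    ys {[]}     _       _          = here refl
∈-listsUpTo (suc n) ys {[]}     _       _          = here refl
∈-listsUpTo (suc n) ys {x ∷ xs} (s≤s h) (px ∷ pxs) =
  there (∈-cartesianProductWith⁺ _∷_ px (∈-listsUpTo n ys h pxs))

unique-lookup-injective : {A : Set} {xs : List A} → Unique xs →
                          ∀ i j → lookup xs i ≡ lookup xs j → i ≡ j
unique-lookup-injective (_  ∷ _) Fin.zero    Fin.zero    _  = refl
unique-lookup-injective (px ∷ _) Fin.zero    (Fin.suc j) eq =
  ⊥-elim (All.lookup px (∈-lookup j) eq)
unique-lookup-injective (px ∷ _) (Fin.suc i) Fin.zero    eq =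
  ⊥-elim (All.lookup px (∈-lookup i) (sym eq))
unique-lookup-injective (_  ∷ u) (Fin.suc i) (Fin.suc j) eq =
  cong Fin.suc (unique-lookup-injective u i j eq)

unique-length≤ : {A : Set} {xs ys : List A} → Unique xs → All (_∈ ys) xs →
                 length xs ℕ.≤ length ys
unique-length≤ {xs = xs} {ys} u sub = Finₚ.injective⇒≤ {f = position} position-injective
  where
  member : ∀ i → lookup xs i ∈ ys
  member i = All.lookup sub (∈-lookup i)

  position : Fin (length xs) → Fin (length ys)
  position i = Any.index (member i)

  position-injective : ∀ {i j} → position i ≡ position j → i ≡ j
  position-injective {i} {j} eq = unique-lookup-injective u i j
    (trans (lookup-index (member i))
      (trans (cong (lookup ys) eq) (sym (lookup-index (member j)))))

enumerateSimple : {A : Set} → DecidableEquality A → (ys : List A) →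
                  {P : Pred (List A) 0ℓ} → Decidable P →
                  (∀ {xs} → P xs → Unique xs) → (∀ {xs} → P xs → All (_∈ ys) xs) →
                  Enumeration P
enumerateSimple _≟_ ys P? P⇒unique P⇒sub = record
  { elements = deduplicate _≟ˡ_ (filter P? candidates)
  ; unique   = DecUniqueₚ.deduplicate-! _≟ˡ_ (filter P? candidates)
  ; sound    = λ m → proj₂ (∈-filter⁻ P? {xs = candidates} (∈-deduplicate⁻ _≟ˡ_ _ m))
  ; complete = λ px → ∈-deduplicate⁺ _≟ˡ_ (∈-filter⁺ P?
      (∈-listsUpTo (length ys) ys (unique-length≤ (P⇒unique px) (P⇒sub px)) (P⇒sub px)) px)
  }
  where
  _≟ˡ_       = Listₚ.≡-dec _≟_
  candidates = listsUpTo (length ys) ys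

_≟ᵖ_ : DecidableEquality Point
_≟ᵖ_ = Productₚ.≡-dec ℤₚ._≟_ ℤₚ._≟_

rectangle : ℕ → ℕ → List Point
rectangle l w = cartesianProduct (map pos (upTo l)) (map pos (upTo w))

∈-range : ∀ n {a} → 0ℤ ℤ.≤ a → a ℤ.≤ pos n ℤ.- 1ℤ → a ∈ map pos (upTo n)
∈-range (suc n) (+≤+ _) (+≤+ a≤n) = ∈-map⁺ pos (∈-upTo⁺ (s≤s a≤n))

∈-rectangle : ∀ {l w p} → InRectangle l w p → p ∈ rectangle l w
∈-rectangle {l} {w} ((0≤a , a≤l) , (0≤b , b≤w)) =
  ∈-cartesianProduct⁺ (∈-range l 0≤a a≤l) (∈-range w 0≤b b≤w)

step? : ∀ t → B.Decidable (Step t)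
step? first  p q = (q ≟ᵖ right p) ⊎-dec ((_ ℙₚ.≟ _) ×-dec (q ≟ᵖ up p))
                                 ⊎-dec ((_ ℙₚ.≟ _) ×-dec (q ≟ᵖ down p))
step? second p q = (q ≟ᵖ right p) ⊎-dec ((_ ℙₚ.≟ _) ×-dec (q ≟ᵖ up p))
                                 ⊎-dec ((_ ℙₚ.≟ _) ×-dec (q ≟ᵖ down p))

inRectangle? : ∀ l w → Decidable (InRectangle l w)
inRectangle? l w (a , b) =
  ((0ℤ ℤₚ.≤? a) ×-dec (a ℤₚ.≤? _)) ×-dec ((0ℤ ℤₚ.≤? b) ×-dec (b ℤₚ.≤? _))

leftPath? : ∀ t l w → Decidable (LeftPath t l w)
leftPath? t l w ps
  with linked? (step? t) ps
     | DecUnique.unique? _≟ᵖ_ ps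
     | All.all? (inRectangle? l w) ps
     | linked? (λ p q → ¬? ((proj₁ p ℤₚ.≟ 0ℤ) ×-dec (proj₁ q ℤₚ.≟ 0ℤ))) ps
     | Finₚ.any? (λ (α : Fin w) → Maybeₚ.≡-dec _≟ᵖ_ (head ps) (just (0ℤ , pos (toℕ α))))
... | yes s | yes u | yes r | yes n | yes h = yes (leftPath s u r n h)
... | no ¬s | _     | _     | _     | _     = no (¬s ∘ LeftPath.steps)
... | yes _ | no ¬u | _     | _     | _     = no (¬u ∘ LeftPath.simple)
... | yes _ | yes _ | no ¬r | _     | _     = no (¬r ∘ LeftPath.inside)
... | yes _ | yes _ | yes _ | no ¬n | _     = no (¬n ∘ LeftPath.notAlongLeft)
... | yes _ | yes _ | yes _ | yes _ | no ¬h = no (¬h ∘ LeftPath.startsOnLeft)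

enumerateLeftPaths : ∀ {t l w} {P : Pred (List Point) 0ℓ} → Decidable P →
                     (∀ {ps} → P ps → LeftPath t l w ps) → Enumeration P
enumerateLeftPaths {l = l} {w} P? P⇒path = enumerateSimple _≟ᵖ_ (rectangle l w) P?
  (LeftPath.simple ∘ P⇒path) (All.map (∈-rectangle {l} {w}) ∘ LeftPath.inside ∘ P⇒path)

pathsTo : ∀ t l w i j → Enumeration (PathTo t l w i j)
pathsTo t l w i j = enumerateLeftPaths {t} {l} {w}
  (λ ps → leftPath? t l w ps ×-dec Maybeₚ.≡-dec _≟ᵖ_ (last ps) (just (pos i , pos j)))
  proj₁

crossingPaths : ∀ t l w → Enumeration (CrossingPath t l w)
crossingPaths t l w = enumerateLeftPaths {t} {l} {w}
  (λ ps → leftPath? t l w ps ×-dec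
    Finₚ.any? (λ (β : Fin w) →
      Maybeₚ.≡-dec _≟ᵖ_ (last ps) (just (pos l ℤ.- 1ℤ , pos (toℕ β)))))
  proj₁

b# : PathType → (l w i j : ℕ) → ℕ
b# t l w i j = # pathsTo t l w i j

-- Entries are listed from the top: index k is the ordinate w-1-k.
b : PathType → (l w i : ℕ) → Vector ℕ w
b t l w i k = b# t l w i (toℕ (opposite k))

𝓑 : PathType → (l w : ℕ) → ℕ
𝓑 t l w = # crossingPaths t l w

Matrix : ℕ → ℕ → Set
Matrix m n = Fin m → Fin n → ℕ

infixl 7 _·_ _·ᵥ_
infixr 8 _^ᴹ_
infixr 6 _⊞_

_·_ : ∀ {m n p} → Matrix m n → Matrix n p → Matrix m p
(M · N) i k = sum λ j → M i j * N j k

_·ᵥ_ : ∀ {m n} → Matrix m n → Vector ℕ n → Vector ℕ m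
(M ·ᵥ v) i = sum λ j → M i j * v j

𝟙 : ∀ {n} → Matrix n n
𝟙 i j with i Finₚ.≟ j
... | yes _ = 1
... | no  _ = 0

_^ᴹ_ : ∀ {n} → Matrix n n → ℕ → Matrix n n
M ^ᴹ zero  = 𝟙
M ^ᴹ suc k = M · (M ^ᴹ k)

ones : ∀ {m n} → Matrix m n
ones _ _ = 1

J : Matrix 2 2
J = ones

-- diag(M, N)
_⊞_ : ∀ {m n} → Matrix m m → Matrix n n → Matrix (m + n) (m + n)
_⊞_ {m} M N i j with splitAt m i | splitAt m j
... | inj₁ i′ | inj₁ j′ = M i′ j′
... | inj₂ i′ | inj₂ j′ = N i′ j′
... | inj₁ _  | inj₂ _  = 0
... | inj₂ _  | inj₁ _  = 0

odd-pred : ∀ n → parity (suc n) ≡ 1ℙ → parity n ≡ 0ℙ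
odd-pred n odd = trans (sym (ℙₚ.suc-homo-⁻¹ n)) (cong _⁻¹ odd)

-- diag(J, …, J)
J-blocks : ∀ n → parity n ≡ 0ℙ → Matrix n n
J-blocks zero          _    ()
J-blocks (suc (suc n)) even = J ⊞ J-blocks n even

-- diag(J, …, J, 1)
M-U : ∀ w → parity w ≡ 1ℙ → Matrix w w
M-U (suc zero)    _   = ones
M-U (suc (suc w)) odd = J ⊞ M-U w odd

-- diag(1, J, …, J)
M-L : ∀ w → parity w ≡ 1ℙ → Matrix w w
M-L (suc w) odd = ones {1} ⊞ J-blocks w (odd-pred w odd)

b₀ : ∀ {w} → Vector ℕ w
b₀ _ = 1

u : ∀ {w} → Matrix 1 w
u = ones

{-# OPTIONS --safe #-}
module Submission where

-- A vertical edge of the first-type wall joins the ordinates j and j+1 of column i exactly when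
-- i + j is even, so each column carries disjoint vertical edges.  A path therefore makes at most one
-- vertical step per column, and the number of paths ending at a point is the sum, over that point
-- and its partner, of the numbers in the preceding column.  Passing to an odd column is thus
-- multiplication by M_U and passing to an even one multiplication by M_L.  As w - 1 is even, the
-- reflection (a , b) ↦ (a , w - 1 - b) keeps parities and exchanges up with down, so it is a
-- bijection between the crossing paths of the two types.

open import Defs
open import Data.Nat.Base using (ℕ; _≤_; _∸_; parity; _/_)
open import Data.Fin.Base using (zero)
open import Data.Parity.Base using (0ℙ; 1ℙ)
open import Data.Product using (_×_)
open import Relation.Binary.PropositionalEquality using (_≡_; _≗_)

open import Data.Empty using (⊥; ⊥-elim)
open import Data.Fin.Base using (Fin; toℕ; fromℕ<; opposite; punchIn) renaming (suc to fsuc)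
import Data.Fin.Properties as Finₚ
open import Data.Integer.Base as ℤ using (1ℤ; ∣_∣; +≤+) renaming (+_ to pos)
import Data.Integer.Properties as ℤₚ
open import Data.Integer.Tactic.RingSolver using (solve-∀)
open import Data.List.Base using (List; []; _∷_; [_]; _++_; _∷ʳ_; _∷ʳ′_; initLast; head; last; map)
import Data.List.Properties as Listₚ
open import Data.List.Membership.Propositional.Properties using (∈-map⁺; ∈-map⁻; ∈-++⁺ˡ; ∈-++⁺ʳ; ∈-++⁻)
open import Data.List.Relation.Unary.All as All using (All; []; _∷_)
import Data.List.Relation.Unary.All.Properties as Allₚ
open import Data.List.Relation.Unary.AllPairs using ([]; _∷_)
import Data.List.Relation.Unary.AllPairs.Properties as AllPairsₚ
open import Data.List.Relation.Unary.Any using (here)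
open import Data.List.Relation.Unary.Linked as Linked using (Linked; []; [-]; _∷_)
import Data.List.Relation.Unary.Linked.Properties as Linkedₚ
open import Data.List.Relation.Unary.Unique.Propositional using (Unique)
import Data.List.Relation.Unary.Unique.Propositional.Properties as Uniqueₚ
open import Data.Maybe.Base as Maybe using (just)
open import Data.Maybe.Properties using (just-injective)
open import Data.Maybe.Relation.Binary.Connected using (Connected; just)
open import Data.Nat.Base using (zero; suc; _+_; _*_; _<_; z≤n; s≤s)
open import Data.Nat.DivMod using (m/n≡1+[m∸n]/n)
import Data.Nat.Properties as ℕₚ
import Data.Parity.Base as ℙ
import Data.Parity.Properties as ℙₚ
open import Data.Product using (_,_; proj₁; proj₂; ∃)
open import Data.Sum.Base as Sum using (_⊎_; inj₁; inj₂)
open import Data.Vec.Functional using (Vector; removeAt)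
open import Function.Base using (_∘_)
open import Level using (0ℓ)
open import Relation.Binary.Core using (Rel)
open import Relation.Binary.PropositionalEquality
  using (_≢_; refl; sym; trans; cong; cong₂; subst; module ≡-Reasoning)
open import Relation.Nullary using (¬_; yes; no)
open import Relation.Unary using (Pred; _⊆_)
open import Algebra.Properties.Semiring.Sum ℕₚ.+-*-semiring
  using (sum; sum-cong-≗; sum-remove; sum-replicate-zero; ∑-comm; *-distribˡ-sum; *-distribʳ-sum)

-- Cardinalities of enumerated sets

module _ {A : Set} {P : Pred A 0ℓ} where

  -- The list of `E`, mapped by `f`, stays free of repetitions and lies inside the list of `F`, so
  -- the pigeonhole bound `unique-length≤` applies.
  #-≤ : {B : Set} {Q : Pred B 0ℓ} (E : Enumeration P) (F : Enumeration Q) (f : A → B) →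
        (∀ {x y} → f x ≡ f y → x ≡ y) → (∀ {x} → P x → Q (f x)) → # E ≤ # F
  #-≤ E F f f-inj P⇒Q = subst (_≤ # F) (Listₚ.length-map f (elements E))
    (unique-length≤ (Uniqueₚ.map⁺ f-inj (unique E))
                    (Allₚ.map⁺ (All.tabulate (complete F ∘ P⇒Q ∘ sound E))))
    where open Enumeration

  -- A count does not depend on how the set is enumerated. This lets the exhaustive search behind
  -- `pathsTo` be exchanged for enumerations built from smaller ones.
  #-cong : {Q : Pred A 0ℓ} (E : Enumeration P) (F : Enumeration Q) → P ⊆ Q → Q ⊆ P → # E ≡ # F
  #-cong E F P⊆Q Q⊆P = ℕₚ.≤-antisym (#-≤ E F (λ x → x) (λ eq → eq) P⊆Q)
                                     (unique-length≤ (unique F) (All.tabulate (complete E ∘ Q⊆P ∘ sound F)))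
    where open Enumeration

  image : {B : Set} (f : A → B) → (∀ {x y} → f x ≡ f y → x ≡ y) →
          Enumeration P → Enumeration (λ y → ∃ λ x → P x × y ≡ f x)
  image f f-inj E = record
    { elements = map f (elements E)
    ; unique   = Uniqueₚ.map⁺ f-inj (unique E)
    ; sound    = λ y∈ → let x , x∈ , eq = ∈-map⁻ f y∈ in x , sound E x∈ , eq
    ; complete = λ { (x , px , refl) → ∈-map⁺ f (complete E px) }
    }
    where open Enumeration

  #-image : {B : Set} (f : A → B) (f-inj : ∀ {x y} → f x ≡ f y → x ≡ y) (E : Enumeration P) →
            # image f f-inj E ≡ # E
  #-image f f-inj E = Listₚ.length-map f (Enumeration.elements E)

  module _ {Q : Pred A 0ℓ} (E : Enumeration P) (F : Enumeration Q)
           (disjoint : ∀ {x} → P x → Q x → ⊥) where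
    open Enumeration

    union : Enumeration (λ x → P x ⊎ Q x)
    union = record
      { elements = elements E ++ elements F
      ; unique   = Uniqueₚ.++⁺ (unique E) (unique F) (λ (x∈E , x∈F) → disjoint (sound E x∈E) (sound F x∈F))
      ; sound    = λ x∈ → Sum.map (sound E) (sound F) (∈-++⁻ (elements E) x∈)
      ; complete = λ { (inj₁ px) → ∈-++⁺ˡ (complete E px)
                     ; (inj₂ qx) → ∈-++⁺ʳ (elements E) (complete F qx) }
      }

    #-union : # union ≡ # E + # F
    #-union = Listₚ.length-++ (elements E)

  transport : {Q : Pred A 0ℓ} → P ⊆ Q → Q ⊆ P → Enumeration P → Enumeration Q
  transport P⊆Q Q⊆P E = record
    { elements = elements E
    ; unique   = unique E
    ; sound    = P⊆Q ∘ sound E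
    ; complete = complete E ∘ Q⊆P
    }
    where open Enumeration

singleton : {A : Set} (x : A) → Enumeration (_≡ x)
singleton x = record
  { elements = [ x ]
  ; unique   = [] ∷ []
  ; sound    = λ { (here eq) → eq }
  ; complete = here
  }

-- Disjointness takes the form that an element determines its index. This serves to sort crossing
-- paths by their end points.
indexedUnion : ∀ {A : Set} n {Q : Fin n → Pred A 0ℓ} (E : ∀ k → Enumeration (Q k)) →
               (∀ {k k′ x} → Q k x → Q k′ x → k ≡ k′) →
               ∃ λ (F : Enumeration (λ x → ∃ λ k → Q k x)) → # F ≡ sum (λ k → # E k)
indexedUnion zero E disjoint = record
  { elements = [] ; unique = [] ; sound = λ () ; complete = λ () } , refl
indexedUnion (suc n) {Q} E disjoint =
  transport (λ { (inj₁ q) → zero , q ; (inj₂ (k , q)) → fsuc k , q })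
            (λ { (zero , q) → inj₁ q ; (fsuc k , q) → inj₂ (k , q) })
            (union (E zero) F headDisjoint) ,
  trans (#-union (E zero) F headDisjoint) (cong (# E zero +_) #F)
  where
  rest = indexedUnion n (E ∘ fsuc) (λ q q′ → Finₚ.suc-injective (disjoint q q′))
  F  = proj₁ rest
  #F = proj₂ rest
  headDisjoint : ∀ {x} → Q zero x → (∃ λ k → Q (fsuc k) x) → ⊥
  headDisjoint q (k , q′) with () ← disjoint q q′

-- Matrices

·ᵥ-cong : ∀ {m n} (M : Matrix m n) {v v′ : Vector ℕ n} → v ≗ v′ → M ·ᵥ v ≗ M ·ᵥ v′
·ᵥ-cong M eq i = sum-cong-≗ (λ j → cong (M i j *_) (eq j))

·-·ᵥ-assoc : ∀ {m n p} (M : Matrix m n) (N : Matrix n p) (v : Vector ℕ p) →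
             (M · N) ·ᵥ v ≗ M ·ᵥ (N ·ᵥ v)
·-·ᵥ-assoc M N v i = begin
  sum (λ k → sum (λ j → M i j * N j k) * v k)   ≡⟨ sum-cong-≗ (λ k → *-distribʳ-sum (v k) (λ j → M i j * N j k)) ⟩
  sum (λ k → sum (λ j → M i j * N j k * v k))   ≡⟨ ∑-comm (λ k j → M i j * N j k * v k) ⟩
  sum (λ j → sum (λ k → M i j * N j k * v k))   ≡⟨ sum-cong-≗ (λ j → sum-cong-≗ (λ k → ℕₚ.*-assoc (M i j) (N j k) (v k))) ⟩
  sum (λ j → sum (λ k → M i j * (N j k * v k))) ≡⟨ sum-cong-≗ (λ j → *-distribˡ-sum (M i j) (λ k → N j k * v k)) ⟨
  sum (λ j → M i j * sum (λ k → N j k * v k))   ∎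
  where open ≡-Reasoning

𝟙-diagonal : ∀ {n} (i : Fin n) → 𝟙 i i ≡ 1
𝟙-diagonal i with i Finₚ.≟ i
... | yes _  = refl
... | no i≢i = ⊥-elim (i≢i refl)

𝟙-offDiagonal : ∀ {n} {i j : Fin n} → i ≢ j → 𝟙 i j ≡ 0
𝟙-offDiagonal {i = i} {j} i≢j with i Finₚ.≟ j
... | yes i≡j = ⊥-elim (i≢j i≡j)
... | no _    = refl

𝟙-·ᵥ : ∀ {n} (v : Vector ℕ n) → 𝟙 ·ᵥ v ≗ v
𝟙-·ᵥ {suc n} v i = begin
  sum (λ j → 𝟙 i j * v j)                               ≡⟨ sum-remove {i = i} (λ j → 𝟙 i j * v j) ⟩
  𝟙 i i * v i + sum (removeAt (λ j → 𝟙 i j * v j) i)    ≡⟨ cong₂ _+_ (cong (_* v i) (𝟙-diagonal i)) (trans (sum-cong-≗ off) (sum-replicate-zero n)) ⟩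
  1 * v i + 0                                           ≡⟨ ℕₚ.+-identityʳ (1 * v i) ⟩
  1 * v i                                               ≡⟨ ℕₚ.*-identityˡ (v i) ⟩
  v i                                                   ∎
  where
  open ≡-Reasoning
  off : ∀ k → 𝟙 i (punchIn i k) * v (punchIn i k) ≡ 0
  off k = cong (_* v (punchIn i k)) (𝟙-offDiagonal (Finₚ.punchInᵢ≢i i k ∘ sym))

-- Block matrices acting on columns listed from the top

-- The path recursion speaks of ordinates, the matrices of indices counted from the top. `b t l w i`
-- is by definition `descending w (b# t l w i)`, and dropping its first entry removes the top
-- ordinate, which suits induction on the size.
descending : ∀ n → (ℕ → ℕ) → Vector ℕ n
descending n f k = f (toℕ (opposite k))

descending-zero : ∀ n f → descending (suc n) f zero ≡ f n
descending-zero n f = cong f (Finₚ.toℕ-fromℕ n)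

descending-suc : ∀ n f k → descending (suc n) f (fsuc k) ≡ descending n f k
descending-suc n f k = cong f (Finₚ.toℕ-inject₁ (opposite k))

module _ (f g : ℕ → ℕ) where

  -- `f` and `g` stand for the counts in two consecutive columns. As functions on all of ℕ they stay
  -- fixed while the size `n` decreases in the inductions below.
  Sends : (n : ℕ) → Matrix n n → Set
  Sends n M = M ·ᵥ descending n f ≗ descending n g

  ones⊞-sends : ∀ {n N} → g n ≡ f n → Sends n N → Sends (suc n) (ones {1} ⊞ N)
  ones⊞-sends {n} {N} gn≡fn N-sends zero = begin
    1 * descending (suc n) f zero + sum {n} (λ _ → 0) ≡⟨ cong₂ _+_ (ℕₚ.*-identityˡ (descending (suc n) f zero)) (sum-replicate-zero n) ⟩
    descending (suc n) f zero + 0                     ≡⟨ ℕₚ.+-identityʳ _ ⟩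
    descending (suc n) f zero                         ≡⟨ descending-zero n f ⟩
    f n                                               ≡⟨ gn≡fn ⟨
    g n                                               ≡⟨ descending-zero n g ⟨
    descending (suc n) g zero                         ∎
    where open ≡-Reasoning
  ones⊞-sends {n} {N} gn≡fn N-sends (fsuc k) = begin
    sum (λ j → N k j * descending (suc n) f (fsuc j)) ≡⟨ ·ᵥ-cong N (descending-suc n f) k ⟩
    (N ·ᵥ descending n f) k                           ≡⟨ N-sends k ⟩
    descending n g k                                  ≡⟨ descending-suc n g k ⟨
    descending (suc n) g (fsuc k)                     ∎
    where open ≡-Reasoning

  J⊞-sends : ∀ {n N} → g n ≡ f n + f (suc n) → g (suc n) ≡ f (suc n) + f n →
             Sends n N → Sends (suc (suc n)) (J ⊞ N)
  J⊞-sends {n} {N} g-lower g-upper N-sends = λ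
    { zero            → trans firstRows (trans (sym g-upper) (sym (descending-zero (suc n) g)))
    ; (fsuc zero)     → trans firstRows (trans (ℕₚ.+-comm (f (suc n)) (f n)) (trans (sym g-lower) (sym (entry₁ g))))
    ; (fsuc (fsuc k)) → trans (·ᵥ-cong N (entry₂₊ f) k) (trans (N-sends k) (sym (entry₂₊ g k)))
    }
    where
    open ≡-Reasoning
    entry₁ : ∀ h → descending (suc (suc n)) h (fsuc zero) ≡ h n
    entry₁ h = trans (descending-suc (suc n) h zero) (descending-zero n h)
    entry₂₊ : ∀ h k → descending (suc (suc n)) h (fsuc (fsuc k)) ≡ descending n h k
    entry₂₊ h k = trans (descending-suc (suc n) h (fsuc k)) (descending-suc n h k)
    v = descending (suc (suc n)) f
    firstRows : 1 * v zero + (1 * v (fsuc zero) + sum {n} (λ _ → 0)) ≡ f (suc n) + f n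
    firstRows = begin
      1 * v zero + (1 * v (fsuc zero) + sum {n} (λ _ → 0)) ≡⟨ cong₂ _+_ (ℕₚ.*-identityˡ (v zero)) (cong₂ _+_ (ℕₚ.*-identityˡ (v (fsuc zero))) (sum-replicate-zero n)) ⟩
      v zero + (v (fsuc zero) + 0)                         ≡⟨ cong (v zero +_) (ℕₚ.+-identityʳ _) ⟩
      v zero + v (fsuc zero)                               ≡⟨ cong₂ _+_ (descending-zero (suc n) f) (entry₁ f) ⟩
      f (suc n) + f n                                      ∎

  PairedSums : ℙ.Parity → ℕ → Set
  PairedSums π n = ∀ j → parity j ≡ π → suc j < n → g j ≡ f j + f (suc j) × g (suc j) ≡ f (suc j) + f j

  PairedSums-pred : ∀ {π n} → PairedSums π (suc n) → PairedSums π n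
  PairedSums-pred paired j jπ j<n = paired j jπ (ℕₚ.m≤n⇒m≤1+n j<n)

  J-blocks-sends : ∀ n even → PairedSums 0ℙ n → Sends n (J-blocks n even)
  J-blocks-sends zero          even paired ()
  -- The first block `J` covers the two top ordinates `n + 1` and `n`; `parity (suc (suc n))`
  -- computes to `parity n`, so `even` also says that the lower one is even.
  J-blocks-sends (suc (suc n)) even paired =
    J⊞-sends (proj₁ (paired n even ℕₚ.≤-refl)) (proj₂ (paired n even ℕₚ.≤-refl))
             (J-blocks-sends n even (PairedSums-pred (PairedSums-pred paired)))

  -- For odd `w` the pairs are 1 with 2, up to `w - 2` with `w - 1`. Ordinate 0 stays alone, and
  -- being listed last it meets the final block 1.
  M-U-sends : ∀ w odd → g 0 ≡ f 0 → PairedSums 1ℙ w → Sends w (M-U w odd)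
  M-U-sends (suc zero)    odd g₀ paired zero = trans (ℕₚ.+-identityʳ (f 0 + 0)) (trans (ℕₚ.+-identityʳ (f 0)) (sym g₀))
  M-U-sends (suc (suc w)) odd g₀ paired =
    J⊞-sends (proj₁ (paired w odd ℕₚ.≤-refl)) (proj₂ (paired w odd ℕₚ.≤-refl))
             (M-U-sends w odd g₀ (PairedSums-pred (PairedSums-pred paired)))

  -- Here the pairs are 0 with 1, up to `w - 3` with `w - 2`, so the top ordinate stays alone and
  -- meets the leading block 1.
  M-L-sends : ∀ w odd → g (w ∸ 1) ≡ f (w ∸ 1) → PairedSums 0ℙ w → Sends w (M-L w odd)
  M-L-sends (suc w) odd g-top paired =
    ones⊞-sends g-top (J-blocks-sends w (odd-pred w odd) (PairedSums-pred paired))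

-- Appending a point to a path

module _ {A : Set} where

  last-∷ʳ : ∀ xs {x : A} → last (xs ∷ʳ x) ≡ just x
  last-∷ʳ []           = refl
  last-∷ʳ (_ ∷ [])     = refl
  last-∷ʳ (_ ∷ y ∷ xs) = last-∷ʳ (y ∷ xs)

  head-∷ʳ : ∀ {xs} {p x : A} → last xs ≡ just p → head (xs ∷ʳ x) ≡ head xs
  head-∷ʳ {_ ∷ _} _ = refl

  All-last : ∀ {P : Pred A 0ℓ} {xs p} → All P xs → last xs ≡ just p → P p
  All-last (px ∷ [])       refl = px
  All-last (_ ∷ pxs@(_ ∷ _)) eq = All-last pxs eq

  unsnoc-last : ∀ {xs} {q : A} → last xs ≡ just q →
                xs ≡ [ q ] ⊎ ∃ λ ys → ∃ λ p → xs ≡ ys ∷ʳ q × last ys ≡ just p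
  unsnoc-last {xs} eq with initLast xs
  ... | ys ∷ʳ′ y with just-injective (trans (sym (last-∷ʳ ys)) eq) | initLast ys
  ... | refl | []        = inj₁ refl
  ... | refl | zs ∷ʳ′ p = inj₂ (zs ∷ʳ p , p , refl , last-∷ʳ zs)

  module _ {R : Rel A 0ℓ} {p q : A} where

    Linked-∷ʳ⁺ : ∀ {xs} → Linked R xs → last xs ≡ just p → R p q → Linked R (xs ∷ʳ q)
    Linked-∷ʳ⁺ rs eq r = Linkedₚ.++⁺ rs (subst (λ m → Connected R m (just q)) (sym eq) (just r)) [-]

    Linked-∷ʳ⁻ : ∀ {xs} → Linked R (xs ∷ʳ q) → last xs ≡ just p → Linked R xs × R p q
    Linked-∷ʳ⁻ {_ ∷ []}    (r ∷ [-]) refl = [-] , r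
    Linked-∷ʳ⁻ {_ ∷ _ ∷ _} (r ∷ rs)  eq   = let rs′ , r′ = Linked-∷ʳ⁻ rs eq in r ∷ rs′ , r′

  Unique-∷ʳ⁺ : ∀ {xs} {q : A} → Unique xs → All (_≢ q) xs → Unique (xs ∷ʳ q)
  Unique-∷ʳ⁺ xs! xs≢q = AllPairsₚ.++⁺ xs! ([] ∷ []) (All.map (_∷ []) xs≢q)

  Unique-∷ʳ⁻ : ∀ {xs} {q : A} → Unique (xs ∷ʳ q) → Unique xs × All (_≢ q) xs
  Unique-∷ʳ⁻ {[]}    _             = [] , []
  Unique-∷ʳ⁻ {_ ∷ _} (x≢ ∷ xs∷ʳq!) =
    let x≢xs , x≢q  = Allₚ.∷ʳ⁻ x≢
        xs!  , xs≢q = Unique-∷ʳ⁻ xs∷ʳq!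
    in x≢xs ∷ xs! , x≢q ∷ xs≢q

-- The conditions under which a path ending at `p` may be prolonged by `q`, one for each condition
-- on a path that the new point affects. Paths grow at their end because the recursion analyses last
-- steps.
record Extension (t : PathType) (l w : ℕ) (ps : List Point) (p q : Point) : Set where
  field
    path         : LeftPath t l w ps
    endsAt       : last ps ≡ just p
    step         : Step t p q
    notAlongLeft : ¬ AlongLeft p q
    inside       : InRectangle l w q
    fresh        : All (_≢ q) ps

module _ {t : PathType} {l w : ℕ} where

  extend : ∀ {ps p q} → Extension t l w ps p q → LeftPath t l w (ps ∷ʳ q)
  extend e = leftPath
    (Linked-∷ʳ⁺ (LeftPath.steps path) endsAt step)
    (Unique-∷ʳ⁺ (LeftPath.simple path) fresh)
    (Allₚ.∷ʳ⁺ (LeftPath.inside path) inside)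
    (Linked-∷ʳ⁺ (LeftPath.notAlongLeft path) endsAt notAlongLeft)
    (let α , eq = LeftPath.startsOnLeft path in α , trans (head-∷ʳ endsAt) eq)
    where open Extension e

  retract : ∀ {ps p q} → LeftPath t l w (ps ∷ʳ q) → last ps ≡ just p → Extension t l w ps p q
  retract path eq =
    let steps , step     = Linked-∷ʳ⁻ (LeftPath.steps path) eq
        simple , fresh   = Unique-∷ʳ⁻ (LeftPath.simple path)
        insides , inside = Allₚ.∷ʳ⁻ (LeftPath.inside path)
        nots , not       = Linked-∷ʳ⁻ (LeftPath.notAlongLeft path) eq
        α , start        = LeftPath.startsOnLeft path
    in record
      { path         = leftPath steps simple insides nots (α , trans (sym (head-∷ʳ eq)) start)
      ; endsAt       = eq
      ; step         = step
      ; notAlongLeft = not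
      ; inside       = inside
      ; fresh        = fresh
      }

  lastStep : ∀ {ps q} → LeftPath t l w ps → last ps ≡ just q →
             ps ≡ [ q ] ⊎ ∃ λ qs → ∃ λ p → ps ≡ qs ∷ʳ q × Extension t l w qs p q
  lastStep path eq with unsnoc-last eq
  ... | inj₁ single                = inj₁ single
  ... | inj₂ (qs , p , refl , eq′) = inj₂ (qs , p , refl , retract path eq′)

-- Steps between points of the rectangle

pt : ℕ → ℕ → Point
pt i j = pos i , pos j

pt-injective : ∀ {i j i′ j′} → pt i j ≡ pt i′ j′ → i ≡ i′ × j ≡ j′
pt-injective eq = ℤₚ.+-injective (cong proj₁ eq) , ℤₚ.+-injective (cong proj₂ eq)

inRectangle⁺ : ∀ {l w i j} → i < l → j < w → InRectangle l w (pt i j)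
inRectangle⁺ (s≤s i≤l) (s≤s j≤w) = (+≤+ z≤n , +≤+ i≤l) , (+≤+ z≤n , +≤+ j≤w)

-- Replaces the integer points of a path by points with natural coordinates, on which pattern
-- matching can proceed.
inRectangle⁻ : ∀ l w {p} → InRectangle l w p → ∃ λ i → ∃ λ j → p ≡ pt i j × i < l × j < w
inRectangle⁻ (suc l) (suc w) ((+≤+ _ , +≤+ i≤l) , (+≤+ _ , +≤+ j≤w)) = _ , _ , refl , s≤s i≤l , s≤s j≤w
inRectangle⁻ zero    _       ((+≤+ _ , ()) , _)
inRectangle⁻ (suc _) zero    (_ , (+≤+ _ , ()))

even⇒odd-suc : ∀ n → parity n ≡ 0ℙ → parity (suc n) ≡ 1ℙ
even⇒odd-suc n even = trans (sym (ℙₚ.⁻¹-involutive (parity (suc n)))) (cong ℙ._⁻¹ (trans (ℙₚ.suc-homo-⁻¹ n) even))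

-- The ordinates joined by a vertical edge of the first-type brick wall in column i.
Adjacent : ℕ → Rel ℕ 0ℓ
Adjacent i j j′ = (parity (i + j) ≡ 0ℙ × j′ ≡ suc j) ⊎ (parity (i + j′) ≡ 0ℙ × j ≡ suc j′)

Adjacent-sym : ∀ {i j j′} → Adjacent i j j′ → Adjacent i j′ j
Adjacent-sym (inj₁ a) = inj₂ a
Adjacent-sym (inj₂ a) = inj₁ a

consecutive-even : ∀ i j → parity (i + j) ≡ 0ℙ → parity (i + suc j) ≢ 0ℙ
consecutive-even i j even even′
  with () ← trans (sym (even⇒odd-suc (i + j) even)) (trans (cong parity (sym (ℕₚ.+-suc i j))) even′)

-- Edges both up and down from `j` would make `i + j` and `i + (j - 1)` even at once. Hence the
-- vertical edges of a column are disjoint.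
Adjacent-functional : ∀ {i j k k′} → Adjacent i j k → Adjacent i j k′ → k ≡ k′
Adjacent-functional (inj₁ (_ , refl)) (inj₁ (_ , refl)) = refl
Adjacent-functional (inj₂ (_ , refl)) (inj₂ (_ , refl)) = refl
Adjacent-functional {i} (inj₁ (e , refl)) (inj₂ (e′ , refl)) = ⊥-elim (consecutive-even i _ e′ e)
Adjacent-functional {i} (inj₂ (e , refl)) (inj₁ (e′ , refl)) = ⊥-elim (consecutive-even i _ e e′)

Adjacent-irrefl : ∀ {i j} → ¬ Adjacent i j j
Adjacent-irrefl (inj₁ (_ , ()))
Adjacent-irrefl (inj₂ (_ , ()))

step⁻ : ∀ {i j i′ j′} → Step first (pt i j) (pt i′ j′) →
        (i′ ≡ suc i × j′ ≡ j) ⊎ (i′ ≡ i × Adjacent i j j′)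
step⁻ {i} (inj₁ eq) =
  let i′≡ , j′≡ = pt-injective eq in inj₁ (trans i′≡ (ℕₚ.+-comm i 1) , j′≡)
step⁻ {i} {j} (inj₂ (inj₁ (even , eq))) =
  let i′≡ , j′≡ = pt-injective eq in inj₂ (i′≡ , inj₁ (even , trans j′≡ (ℕₚ.+-comm j 1)))
-- A step down from ordinate 0 would end at the ordinate -1, which is not a natural number.
step⁻ {i} {zero}  (inj₂ (inj₂ (odd , eq))) with () ← cong proj₂ eq
step⁻ {i} {suc j} (inj₂ (inj₂ (odd , eq))) with refl , refl ← pt-injective eq =
  inj₂ (refl , inj₂ (odd-pred (i + j) (trans (cong parity (sym (ℕₚ.+-suc i j))) odd) , refl))

horizontal : ∀ {i j} → Step first (pt i j) (pt (suc i) j)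
horizontal {i} {j} = inj₁ (cong (λ n → pt n j) (ℕₚ.+-comm 1 i))

vertical : ∀ {i j j′} → Adjacent i j j′ → Step first (pt i j) (pt i j′)
vertical {i} {j}          (inj₁ (even , refl)) = inj₂ (inj₁ (even , cong (pt i) (ℕₚ.+-comm 1 j)))
vertical {i} {j′ = j′} (inj₂ (even , refl)) =
  inj₂ (inj₂ (trans (cong parity (ℕₚ.+-suc i j′)) (even⇒odd-suc (i + j′) even) , refl))

step-abscissa : ∀ t {p q} → Step t p q → proj₁ p ℤ.≤ proj₁ q
step-abscissa first  {a , _} (inj₁ refl)              = ℤₚ.i≤i+j a 1ℤ
step-abscissa first  (inj₂ (inj₁ (_ , refl))) = ℤₚ.≤-refl
step-abscissa first  (inj₂ (inj₂ (_ , refl))) = ℤₚ.≤-refl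
step-abscissa second {a , _} (inj₁ refl)              = ℤₚ.i≤i+j a 1ℤ
step-abscissa second (inj₂ (inj₁ (_ , refl))) = ℤₚ.≤-refl
step-abscissa second (inj₂ (inj₂ (_ , refl))) = ℤₚ.≤-refl

-- No step moves left, so the last point has the greatest abscissa. Any point further to the right
-- is therefore fresh.
steps-abscissa : ∀ t {ps p} → Linked (Step t) ps → last ps ≡ just p →
                 All (λ q → proj₁ q ℤ.≤ proj₁ p) ps
steps-abscissa t [-]                refl = ℤₚ.≤-refl ∷ []
steps-abscissa t (s ∷ ss@[-])     eq   with px ∷ pxs ← steps-abscissa t ss eq = ℤₚ.≤-trans (step-abscissa t s) px ∷ px ∷ pxs
steps-abscissa t (s ∷ ss@(_ ∷ _)) eq   with px ∷ pxs ← steps-abscissa t ss eq = ℤₚ.≤-trans (step-abscissa t s) px ∷ px ∷ pxs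

-- The recursion from column to column

After : Pred (List Point) 0ℓ → Point → Pred (List Point) 0ℓ
After P q ps = ∃ λ qs → P qs × ps ≡ qs ∷ʳ q

module _ {l w : ℕ} where

  -- A last step into column 0 would be horizontal from outside the rectangle or vertical along the
  -- left side, and both are excluded.
  pathToLeftSide : ∀ {j ps} → PathTo first l w 0 j ps → ps ≡ [ pt 0 j ]
  pathToLeftSide (path , eq) with lastStep path eq
  ... | inj₁ single = single
  ... | inj₂ (qs , p , refl , e)
      with inRectangle⁻ l w (All-last (LeftPath.inside (Extension.path e)) (Extension.endsAt e))
  ... | i , j , refl , _ with step⁻ (Extension.step e)
  ... | inj₂ (refl , _) = ⊥-elim (Extension.notAlongLeft e (refl , refl))

  trivialPath : ∀ {j} → 0 < l → j < w → PathTo first l w 0 j [ pt 0 j ]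
  trivialPath 0<l j<w =
    leftPath [-] ([] ∷ []) (inRectangle⁺ 0<l j<w ∷ []) [-]
             (fromℕ< j<w , cong (λ n → just (pt 0 n)) (sym (Finₚ.toℕ-fromℕ< j<w))) , refl

  module _ {r : ℕ} (r<l : suc r < l) where

    enterColumn : ∀ {j} → j < w → After (PathTo first l w r j) (pt (suc r) j) ⊆ PathTo first l w (suc r) j
    enterColumn j<w (qs , (path , eq) , refl) = extend (record
      { path         = path
      ; endsAt       = eq
      ; step         = horizontal
      ; notAlongLeft = λ { (_ , ()) }
      ; inside       = inRectangle⁺ r<l j<w
      ; fresh        = All.map (λ { a≤r refl → ℕₚ.1+n≰n (ℤₚ.drop‿+≤+ a≤r) })
                               (steps-abscissa first (LeftPath.steps path) eq)
      }) , last-∷ʳ qs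

    turnInColumn : ∀ {j j′} → j < w → j′ < w → Adjacent (suc r) j′ j →
                   After (After (PathTo first l w r j′) (pt (suc r) j′)) (pt (suc r) j) ⊆ PathTo first l w (suc r) j
    turnInColumn {j} {j′} j<w j′<w adj (_ , after@(qs , (path , eq) , refl) , refl) =
      let path′ , eq′ = enterColumn j′<w after in extend (record
      { path         = path′
      ; endsAt       = eq′
      ; step         = vertical adj
      ; notAlongLeft = λ { (_ , ()) }
      ; inside       = inRectangle⁺ r<l j<w
      -- The points of `qs` lie in columns up to `r`; the only earlier point in column `r + 1` has
      -- ordinate `j′`, which differs from its neighbour `j`.
      ; fresh        = Allₚ.∷ʳ⁺
          (All.map (λ { a≤r refl → ℕₚ.1+n≰n (ℤₚ.drop‿+≤+ a≤r) }) (steps-abscissa first (LeftPath.steps path) eq))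
          (λ { refl → Adjacent-irrefl {suc r} adj })
      }) , last-∷ʳ (qs ∷ʳ pt (suc r) j′)

  -- The vertical case retains the freshness of the end point, which is what excludes a second
  -- vertical step in the same column.
  lastMove : ∀ {r j ps} → PathTo first l w (suc r) j ps →
             After (PathTo first l w r j) (pt (suc r) j) ps ⊎
             ∃ λ j′ → j′ < w × Adjacent (suc r) j′ j ×
             After (λ qs → PathTo first l w (suc r) j′ qs × All (_≢ pt (suc r) j) qs) (pt (suc r) j) ps
  lastMove (path , eq) with lastStep path eq
  -- A one-point path begins on the left side, so it cannot end in column `r + 1`.
  ... | inj₁ refl with () ← proj₂ (LeftPath.startsOnLeft path)
  ... | inj₂ (qs , p , refl , e)
      with inRectangle⁻ l w (All-last (LeftPath.inside (Extension.path e)) (Extension.endsAt e))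
  ... | i , j′ , refl , _ , j′<w with step⁻ (Extension.step e)
  ... | inj₁ (refl , refl) = inj₁ (qs , (Extension.path e , Extension.endsAt e) , refl)
  ... | inj₂ (refl , adj)  = inj₂ (j′ , j′<w , adj , qs ,
          ((Extension.path e , Extension.endsAt e) , Extension.fresh e) , refl)

  -- A second vertical step in a column would lead back to where the first one started.
  lastMoves : ∀ {r j ps} → PathTo first l w (suc r) j ps →
              After (PathTo first l w r j) (pt (suc r) j) ps ⊎
              ∃ λ j′ → j′ < w × Adjacent (suc r) j′ j ×
              After (After (PathTo first l w r j′) (pt (suc r) j′)) (pt (suc r) j) ps
  lastMoves {r} to with lastMove to
  ... | inj₁ straight = inj₁ straight
  ... | inj₂ (j′ , j′<w , adj , qs , (to′ , fresh) , refl) with lastMove to′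
  ... | inj₁ straight = inj₂ (j′ , j′<w , adj , qs , straight , refl)
  ... | inj₂ (j″ , _ , adj′ , xs , ((_ , eq) , _) , refl)
      with refl ← Adjacent-functional {suc r} (Adjacent-sym {suc r} adj′) adj =
        ⊥-elim (All-last (proj₁ (Allₚ.∷ʳ⁻ {xs = xs} fresh)) eq refl)

  b#-zero : ∀ {j} → 0 < l → j < w → b# first l w 0 j ≡ 1
  b#-zero {j} 0<l j<w = #-cong (pathsTo first l w 0 j) (singleton [ pt 0 j ])
    pathToLeftSide (λ { refl → trivialPath 0<l j<w })

  module _ {r : ℕ} (r<l : suc r < l) where

    private
      after : ∀ {P} q → Enumeration P → Enumeration (After P q)
      after q E = image (_∷ʳ q) (Listₚ.∷ʳ-injectiveˡ _ _) E

      #-after : ∀ {P} q (E : Enumeration P) → # after q E ≡ # E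
      #-after q E = #-image (_∷ʳ q) (Listₚ.∷ʳ-injectiveˡ _ _) E

      straight : ∀ j → Enumeration (After (PathTo first l w r j) (pt (suc r) j))
      straight j = after (pt (suc r) j) (pathsTo first l w r j)

      #-straight : ∀ j → # straight j ≡ b# first l w r j
      #-straight j = #-after (pt (suc r) j) (pathsTo first l w r j)

    b#-isolated : ∀ {j} → j < w → (∀ {j′} → j′ < w → ¬ Adjacent (suc r) j′ j) →
                  b# first l w (suc r) j ≡ b# first l w r j
    b#-isolated {j} j<w isolated = trans
      (#-cong (pathsTo first l w (suc r) j) (straight j) to (enterColumn r<l j<w))
      (#-straight j)
      where
      to : PathTo first l w (suc r) j ⊆ After (PathTo first l w r j) (pt (suc r) j)
      to path with lastMoves path
      ... | inj₁ s                   = s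
      ... | inj₂ (_ , j′<w , adj , _) = ⊥-elim (isolated j′<w adj)

    -- A path to `(r + 1 , j)` enters column `r + 1` either at `j` itself or at its unique partner
    -- `j′`. Removing its points in that column leaves an arbitrary path to `(r , j)` or to
    -- `(r , j′)`.
    b#-adjacent : ∀ {j j′} → j < w → j′ < w → Adjacent (suc r) j′ j →
                  b# first l w (suc r) j ≡ b# first l w r j + b# first l w r j′
    b#-adjacent {j} {j′} j<w j′<w adj = begin
      b# first l w (suc r) j              ≡⟨ #-cong (pathsTo first l w (suc r) j) (union (straight j) turning disjoint) to from ⟩
      # union (straight j) turning disjoint ≡⟨ #-union (straight j) turning disjoint ⟩
      # straight j + # turning            ≡⟨ cong₂ _+_ (#-straight j) (trans (#-after (pt (suc r) j) (straight j′)) (#-straight j′)) ⟩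
      b# first l w r j + b# first l w r j′ ∎
      where
      open ≡-Reasoning
      Turning  = After (After (PathTo first l w r j′) (pt (suc r) j′)) (pt (suc r) j)
      Straight = After (PathTo first l w r j) (pt (suc r) j)
      turning : Enumeration Turning
      turning = after (pt (suc r) j) (straight j′)
      -- The last point but one lies in column `r` for a straight path and in column `r + 1` for a
      -- turning one.
      disjoint : ∀ {ps} → Straight ps → Turning ps → ⊥
      disjoint (qs , (_ , eq) , refl) (_ , (qs′ , _ , refl) , eq′)
        with refl ← Listₚ.∷ʳ-injectiveˡ qs _ eq′
        with () ← ℕₚ.1+n≢n (proj₁ (pt-injective (just-injective (trans (sym (last-∷ʳ qs′)) eq))))
      to : PathTo first l w (suc r) j ⊆ λ ps → Straight ps ⊎ Turning ps
      to path with lastMoves path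
      ... | inj₁ s = inj₁ s
      ... | inj₂ (j″ , _ , adj′ , t)
          with refl ← Adjacent-functional {suc r} (Adjacent-sym {suc r} adj) (Adjacent-sym {suc r} adj′) = inj₂ t
      from : (λ ps → Straight ps ⊎ Turning ps) ⊆ PathTo first l w (suc r) j
      from (inj₁ s) = enterColumn r<l j<w s
      from (inj₂ t) = turnInColumn r<l j<w j′<w adj t

-- From column recursion to matrix powers

odd⇒positive : ∀ {n} → parity n ≡ 1ℙ → 0 < n
odd⇒positive {suc n} _ = s≤s z≤n

parity-+ : ∀ {m n π π′} → parity m ≡ π → parity n ≡ π′ → parity (m + n) ≡ π ℙ.+ π′
parity-+ {m} {n} mπ nπ′ = trans (ℙₚ.+-homo-+ m n) (cong₂ ℙ._+_ mπ nπ′)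

even⇒half-suc : ∀ r → parity r ≡ 0ℙ → suc r / 2 ≡ r / 2
even⇒half-suc zero          _    = refl
even⇒half-suc (suc (suc r)) even = begin
  suc (suc (suc r)) / 2 ≡⟨ m/n≡1+[m∸n]/n {suc (suc (suc r))} {2} (s≤s (s≤s z≤n)) ⟩
  suc (suc r / 2)       ≡⟨ cong suc (even⇒half-suc r even) ⟩
  suc (r / 2)           ≡⟨ m/n≡1+[m∸n]/n {suc (suc r)} {2} (s≤s (s≤s z≤n)) ⟨
  suc (suc r) / 2       ∎
  where open ≡-Reasoning

module _ {l w : ℕ} (odd : parity w ≡ 1ℙ) where

  module _ {r : ℕ} (r<l : suc r < l) where

    adjacentSums : ∀ {j} → parity (suc r + j) ≡ 0ℙ → suc j < w →
                   b# first l w (suc r) j       ≡ b# first l w r j + b# first l w r (suc j) ×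
                   b# first l w (suc r) (suc j) ≡ b# first l w r (suc j) + b# first l w r j
    adjacentSums even j<w =
      b#-adjacent r<l (ℕₚ.<⇒≤ j<w) j<w (inj₂ (even , refl)) ,
      b#-adjacent r<l j<w (ℕₚ.<⇒≤ j<w) (inj₁ (even , refl))

    -- Edges in an odd column have odd lower ends, so ordinate 0 has no partner.
    oddColumn : parity (suc r) ≡ 1ℙ → b first l w (suc r) ≗ M-U w odd ·ᵥ b first l w r
    oddColumn r-odd k = sym (M-U-sends (b# first l w r) (b# first l w (suc r)) w odd
      (b#-isolated r<l (odd⇒positive odd) isolated)
      (λ j j-odd → adjacentSums (parity-+ {suc r} r-odd j-odd)) k)
      where
      isolated : ∀ {j} → j < w → ¬ Adjacent (suc r) j 0
      isolated _ (inj₂ (even , _)) with () ← trans (sym (parity-+ {suc r} {0} r-odd refl)) even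

    -- Edges in an even column have even lower ends. As `w - 1` is even, its edge would lead up to
    -- `w`, outside the rectangle, and `w - 2` is odd, so no edge arrives from below.
    evenColumn : parity (suc r) ≡ 0ℙ → b first l w (suc r) ≗ M-L w odd ·ᵥ b first l w r
    evenColumn r-even k = sym (M-L-sends (b# first l w r) (b# first l w (suc r)) w odd
      (b#-isolated r<l (ℕₚ.≤-reflexive w-1+1≡w) isolated)
      (λ j j-even → adjacentSums (parity-+ {suc r} r-even j-even)) k)
      where
      w-1+1≡w : suc (w ∸ 1) ≡ w
      w-1+1≡w = ℕₚ.m+[n∸m]≡n (odd⇒positive odd)
      isolated : ∀ {j} → j < w → ¬ Adjacent (suc r) j (w ∸ 1)
      isolated {j} _ (inj₁ (even , top))
        with () ← trans (sym (parity-+ {suc r} {j} r-even (trans (cong parity (trans (cong suc (sym top)) w-1+1≡w)) odd))) even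
      isolated j<w (inj₂ (_ , refl)) = ℕₚ.<-irrefl w-1+1≡w j<w

  private
    U = M-U w odd
    L = M-L w odd

  evenColumns : ∀ r → r < l → parity r ≡ 0ℙ → b first l w r ≗ (L · U) ^ᴹ (r / 2) ·ᵥ b₀
  evenColumns zero          r<l even k = trans (b#-zero r<l (Finₚ.toℕ<n (opposite k))) (sym (𝟙-·ᵥ b₀ k))
  evenColumns (suc (suc r)) r<l even k = begin
    b first l w (suc (suc r)) k                  ≡⟨ evenColumn r<l even k ⟩
    (L ·ᵥ b first l w (suc r)) k                 ≡⟨ ·ᵥ-cong L (oddColumn (ℕₚ.<⇒≤ r<l) (even⇒odd-suc r even)) k ⟩
    (L ·ᵥ (U ·ᵥ b first l w r)) k                ≡⟨ ·-·ᵥ-assoc L U (b first l w r) k ⟨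
    (L · U ·ᵥ b first l w r) k                   ≡⟨ ·ᵥ-cong (L · U) (evenColumns r (ℕₚ.<⇒≤ (ℕₚ.<⇒≤ r<l)) even) k ⟩
    (L · U ·ᵥ ((L · U) ^ᴹ (r / 2) ·ᵥ b₀)) k      ≡⟨ ·-·ᵥ-assoc (L · U) ((L · U) ^ᴹ (r / 2)) b₀ k ⟨
    ((L · U) ^ᴹ suc (r / 2) ·ᵥ b₀) k             ≡⟨ cong (λ ρ → ((L · U) ^ᴹ ρ ·ᵥ b₀) k) (m/n≡1+[m∸n]/n {suc (suc r)} {2} (s≤s (s≤s z≤n))) ⟨
    ((L · U) ^ᴹ (suc (suc r) / 2) ·ᵥ b₀) k       ∎
    where open ≡-Reasoning

  oddColumns : ∀ r → r < l → parity r ≡ 1ℙ → b first l w r ≗ U · (L · U) ^ᴹ (r / 2) ·ᵥ b₀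
  oddColumns (suc r) r<l r-odd k = begin
    b first l w (suc r) k                     ≡⟨ oddColumn r<l r-odd k ⟩
    (U ·ᵥ b first l w r) k                    ≡⟨ ·ᵥ-cong U (evenColumns r (ℕₚ.<⇒≤ r<l) even) k ⟩
    (U ·ᵥ ((L · U) ^ᴹ (r / 2) ·ᵥ b₀)) k       ≡⟨ ·-·ᵥ-assoc U ((L · U) ^ᴹ (r / 2)) b₀ k ⟨
    -- The preceding index `r` is even, so it has the same half, rounded down, as `suc r`.
    (U · (L · U) ^ᴹ (r / 2) ·ᵥ b₀) k          ≡⟨ cong (λ ρ → (U · (L · U) ^ᴹ ρ ·ᵥ b₀) k) (even⇒half-suc r even) ⟨
    (U · (L · U) ^ᴹ (suc r / 2) ·ᵥ b₀) k      ∎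
    where
    open ≡-Reasoning
    even = odd-pred r r-odd

-- Each crossing path has exactly one end point on the right side, so the crossing paths split into
-- the disjoint classes counted by the entries of the last column.
crossings-by-endpoint : ∀ {l} w → 1 ≤ l → 𝓑 first l w ≡ (u ·ᵥ b first l w (l ∸ 1)) zero
crossings-by-endpoint {suc l} w _ = begin
  𝓑 first (suc l) w                               ≡⟨ #-cong (crossingPaths first (suc l) w) (proj₁ ends)
                                                      -- Entries of `b` are listed from the top, so
                                                      -- an end at height `β` belongs to the index
                                                      -- `opposite β`.
                                                      (λ { (path , β , eq) → opposite β , path , trans eq (cong (λ k → just (pt l (toℕ k))) (sym (Finₚ.opposite-involutive β))) })
                                                      (λ { (k , path , eq) → path , opposite k , eq }) ⟩
  # proj₁ ends                                    ≡⟨ proj₂ ends ⟩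
  sum (b first (suc l) w l)                       ≡⟨ sum-cong-≗ (λ k → ℕₚ.*-identityˡ (b first (suc l) w l k)) ⟨
  (u ·ᵥ b first (suc l) w l) zero                 ∎
  where
  open ≡-Reasoning
  opposite-injective : {k k′ : Fin w} → opposite k ≡ opposite k′ → k ≡ k′
  opposite-injective {k} {k′} eq =
    trans (sym (Finₚ.opposite-involutive k)) (trans (cong opposite eq) (Finₚ.opposite-involutive k′))
  ends = indexedUnion w (λ k → pathsTo first (suc l) w l (toℕ (opposite k)))
    (λ { (_ , eq) (_ , eq′) → opposite-injective (Finₚ.toℕ-injective
           (proj₂ (pt-injective {l} {_} {l} (just-injective (trans (sym eq) eq′))))) })

-- Reflection of the strip

-- Lowering both numbers by one keeps the difference and changes the sum by two, so difference and
-- sum agree in parity, whatever the sign of the difference.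
parity-∣⊖∣ : ∀ m n → parity ∣ m ℤ.⊖ n ∣ ≡ parity m ℙ.+ parity n
parity-∣⊖∣ zero    zero    = refl
parity-∣⊖∣ zero    (suc n) = refl
parity-∣⊖∣ (suc m) zero    = sym (ℙₚ.+-identityʳ (parity (suc m)))
parity-∣⊖∣ (suc m) (suc n) = begin
  parity ∣ suc m ℤ.⊖ suc n ∣              ≡⟨ cong (parity ∘ ∣_∣) (ℤₚ.[1+m]⊖[1+n]≡m⊖n m n) ⟩
  parity ∣ m ℤ.⊖ n ∣                      ≡⟨ parity-∣⊖∣ m n ⟩
  parity m ℙ.+ parity n                   ≡⟨ ℙₚ.+-homo-+ m n ⟨
  parity (suc (suc (m + n)))              ≡⟨ cong (parity ∘ suc) (ℕₚ.+-suc m n) ⟨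
  parity (suc m + suc n)                  ≡⟨ ℙₚ.+-homo-+ (suc m) (suc n) ⟩
  parity (suc m) ℙ.+ parity (suc n)       ∎
  where open ≡-Reasoning

parity-even-minus : ∀ {c} → parity c ≡ 0ℙ → ∀ b → parity ∣ pos c ℤ.- b ∣ ≡ parity ∣ b ∣
parity-even-minus {c} even (pos n) = begin
  parity ∣ pos c ℤ.- pos n ∣ ≡⟨ cong (parity ∘ ∣_∣) (ℤₚ.m-n≡m⊖n c n) ⟩
  parity ∣ c ℤ.⊖ n ∣         ≡⟨ parity-∣⊖∣ c n ⟩
  parity c ℙ.+ parity n      ≡⟨ cong (ℙ._+ parity n) even ⟩
  parity n                   ∎
  where open ≡-Reasoning
-- Subtracting a negative integer computes to the natural sum `c + suc n`.
parity-even-minus {c} even ℤ.-[1+ n ] = parity-+ {c} {suc n} even refl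

head-map : ∀ {A B : Set} (f : A → B) xs → head (map f xs) ≡ Maybe.map f (head xs)
head-map f []      = refl
head-map f (_ ∷ _) = refl

flip : PathType → PathType
flip first  = second
flip second = first

module _ {c : ℕ} (even : parity c ≡ 0ℙ) where

  -- With `c = w - 1` this is the reflection in the horizontal midline of the rectangle.
  reflect : Point → Point
  reflect (a , b) = a , pos c ℤ.- b

  reflect-involutive : ∀ p → reflect (reflect p) ≡ p
  reflect-involutive (a , b) = cong (a ,_) (c-[c-b]≡b (pos c) b)
    where
    c-[c-b]≡b : ∀ c b → c ℤ.- (c ℤ.- b) ≡ b
    c-[c-b]≡b = solve-∀

  reflect-injective : ∀ {p q} → reflect p ≡ reflect q → p ≡ q
  reflect-injective {p} {q} eq =
    trans (sym (reflect-involutive p)) (trans (cong reflect eq) (reflect-involutive q))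

  reflect-parity : ∀ {π} ((a , b) : Point) → parity (∣ a ∣ + ∣ b ∣) ≡ π →
                   parity (∣ a ∣ + ∣ proj₂ (reflect (a , b)) ∣) ≡ π
  reflect-parity (a , b) eq = begin
    parity (∣ a ∣ + ∣ pos c ℤ.- b ∣)           ≡⟨ ℙₚ.+-homo-+ ∣ a ∣ ∣ pos c ℤ.- b ∣ ⟩
    parity ∣ a ∣ ℙ.+ parity ∣ pos c ℤ.- b ∣    ≡⟨ cong (parity ∣ a ∣ ℙ.+_) (parity-even-minus even b) ⟩
    parity ∣ a ∣ ℙ.+ parity ∣ b ∣              ≡⟨ ℙₚ.+-homo-+ ∣ a ∣ ∣ b ∣ ⟨
    parity (∣ a ∣ + ∣ b ∣)                     ≡⟨ eq ⟩
    _                                          ∎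
    where open ≡-Reasoning

  reflect-up : ∀ p → reflect (up p) ≡ down (reflect p)
  reflect-up (a , b) = cong (a ,_) (lemma (pos c) b)
    where
    lemma : ∀ c b → c ℤ.- (b ℤ.+ 1ℤ) ≡ c ℤ.- b ℤ.- 1ℤ
    lemma = solve-∀

  reflect-down : ∀ p → reflect (down p) ≡ up (reflect p)
  reflect-down (a , b) = cong (a ,_) (lemma (pos c) b)
    where
    lemma : ∀ c b → c ℤ.- (b ℤ.- 1ℤ) ≡ c ℤ.- b ℤ.+ 1ℤ
    lemma = solve-∀

  -- The reflection preserves the parity of a point and reverses vertical steps, which is precisely
  -- how the two types differ.
  reflect-step : ∀ t {p q} → Step t p q → Step (flip t) (reflect p) (reflect q)
  reflect-step first      (inj₁ refl)            = inj₁ refl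
  reflect-step first  {p} (inj₂ (inj₁ (π , refl))) = inj₂ (inj₂ (reflect-parity p π , reflect-up p))
  reflect-step first  {p} (inj₂ (inj₂ (π , refl))) = inj₂ (inj₁ (reflect-parity p π , reflect-down p))
  reflect-step second     (inj₁ refl)            = inj₁ refl
  reflect-step second {p} (inj₂ (inj₁ (π , refl))) = inj₂ (inj₂ (reflect-parity p π , reflect-up p))
  reflect-step second {p} (inj₂ (inj₂ (π , refl))) = inj₂ (inj₁ (reflect-parity p π , reflect-down p))

  reflect-pt : ∀ {i j} → j < suc c → reflect (pt i j) ≡ pt i (c ∸ j)
  reflect-pt {i} {j} (s≤s j≤c) = cong (pos i ,_) (trans (ℤₚ.m-n≡m⊖n c j) (ℤₚ.⊖-≥ j≤c))

  reflect-inside : ∀ {l p} → InRectangle l (suc c) p → InRectangle l (suc c) (reflect p)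
  reflect-inside {l} inside with inRectangle⁻ l (suc c) inside
  ... | i , j , refl , i<l , j<w = subst (InRectangle l (suc c)) (sym (reflect-pt j<w))
                                         (inRectangle⁺ i<l (s≤s (ℕₚ.m∸n≤m c j)))

  reflect-onColumn : ∀ {i} (α : Fin (suc c)) → reflect (pt i (toℕ α)) ≡ pt i (toℕ (opposite α))
  reflect-onColumn {i} α = trans (reflect-pt (Finₚ.toℕ<n α)) (cong (pt i) (sym (Finₚ.opposite-prop α)))

  reflect-crossing : ∀ {t l ps} → CrossingPath t (suc l) (suc c) ps → CrossingPath (flip t) (suc l) (suc c) (map reflect ps)
  reflect-crossing {t} {l} {ps} (path , β , end) = leftPath
    (Linkedₚ.map⁺ (Linked.map (reflect-step t) steps))
    (Uniqueₚ.map⁺ reflect-injective simple)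
    (Allₚ.map⁺ (All.map (reflect-inside {suc l}) inside))
    -- `AlongLeft` looks only at abscissae, which `reflect` fixes, so the condition carries over
    -- unchanged.
    (Linkedₚ.map⁺ notAlongLeft)
    (opposite α , trans (head-map reflect ps) (trans (cong (Maybe.map reflect) start) (cong just (reflect-onColumn α)))) ,
    opposite β , trans (Listₚ.last-map reflect ps) (trans (cong (Maybe.map reflect) end) (cong just (reflect-onColumn {l} β)))
    where
    open LeftPath path
    α = proj₁ startsOnLeft
    start = proj₂ startsOnLeft

  -- Reflecting every point maps the paths of each type injectively to those of the other, which
  -- gives both inequalities.
  crossings-flip : ∀ l → 𝓑 first (suc l) (suc c) ≡ 𝓑 second (suc l) (suc c)
  crossings-flip l = ℕₚ.≤-antisym (#-≤ F S (map reflect) map-reflect-injective reflect-crossing)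
                                 (#-≤ S F (map reflect) map-reflect-injective reflect-crossing)
    where
    F = crossingPaths first  (suc l) (suc c)
    S = crossingPaths second (suc l) (suc c)
    map-reflect-injective : ∀ {ps qs} → map reflect ps ≡ map reflect qs → ps ≡ qs
    map-reflect-injective = Listₚ.map-injective reflect-injective

theorem2p3 : (l w : ℕ) → 2 ≤ l → 2 ≤ w → (odd : parity w ≡ 1ℙ) →
    let U = M-U w odd
        L = M-L w odd
    in
    ((r : ℕ) → 1 ≤ r → r ≤ l ∸ 1 →
      (parity r ≡ 0ℙ → b first l w r ≗ (L · U) ^ᴹ (r / 2) ·ᵥ b₀) ×
      (parity r ≡ 1ℙ → b first l w r ≗ U · (L · U) ^ᴹ (r / 2) ·ᵥ b₀)) ×
    𝓑 first l w ≡ 𝓑 second l w ×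
    𝓑 first l w ≡ (u ·ᵥ b first l w (l ∸ 1)) zero
theorem2p3 (suc l) (suc c) 2≤l 2≤w odd =
  -- The length here is `suc l`, so `s≤s` turns the bound `r ≤ l` into the strict bound required of
  -- a column index.
  (λ r _ r≤l → evenColumns odd r (s≤s r≤l) , oddColumns odd r (s≤s r≤l)) ,
  crossings-flip {c} (odd-pred c odd) l ,
  crossings-by-endpoint (suc c) (s≤s z≤n)
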